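{- Let $n,m\ge1$, let $w=w_1\cdots w_n\in W_{n,m}$ be a word of length $n$ in the alphabet $[m]=\{1,\ldots,m\}$, and let $\pi=\Phi^{ -1}(D(w))$. Then the shape of $\pi$ is $(L_m(w),L_{m-1}(w),\ldots,L_1(w))$ (trailing zeros being allowed).
   Context: A plane partition $\pi=(\pi_{ij})_{i,j\ge1}$ is a two-dimensional array of nonnegative integers with finitely many nonzero entries such that $\pi_{ij}\ge\pi_{i+1\,j}$ and $\pi_{ij}\ge\pi_{i\,j+1}$ for all $i,j$ ($i$ is the row index, $j$ the column index); its shape is the partition whose Young diagram is $\{(i,j):\pi_{ij}>0\}$, i.e. the sequence of numbers of nonzero entries in the rows. $\Phi$ is the map sending a plane partition $\pi$ with at most $m$ nonzero rows and all entries at most $n$ to the $m\times n$ matrix $(d_{i\ell})_{1\le i\le m,\,1\le\ell\le n}$ of nonnegative integers with $d_{i\ell}=|\{j:\pi_{ij}=\ell>\pi_{i+1\,j}\}|$. This map is a bijection from the set of such plane partitions (with no restriction on the number of columns) onto the set of $m\times n$ matrices of nonnegative integers; $\Phi^{ -1}$ is its inverse. For a word $w=w_1\cdots w_n\in W_{n,m}$, $D(w)=(d_{ij})$ is the $m\times n$ $01$-matrix with $d_{w_i,i}=1$ for all $i\in[n]$ and all other entries zero. A weakly increasing subsequence of $w$ is a sequence $w_{i_1}\le\cdots\le w_{i_k}$ with $1\le i_1<\cdots<i_k\le n$; $k$ is its length. $L_i(w)$ is the maximal length of a weakly increasing subsequence of $w$ all of whose letters belong to $\{m-i+1,\ldots,m\}$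 (equal to $0$ if no such letters occur in $w$). -}

module Defs where

open import Data.Bool.Base using (true; false; if_then_else_)
open import Data.Fin as Fin using (Fin; toℕ; fromℕ<)
import Data.Fin.Properties as Finₚ
open import Data.List.Base using (List; []; _∷_; _++_; map; filter; length; upTo)
open import Data.List.Extrema.Nat using (max)
open import Data.List.Membership.Propositional using (_∈_)
open import Data.List.Membership.Propositional.Properties
  using (∈-map⁺; ∈-map⁻; ∈-++⁺ˡ; ∈-++⁺ʳ; ∈-++⁻)
open import Data.List.Properties using (filter-++; length-++; upTo-∷ʳ)
open import Data.List.Relation.Binary.Sublist.Propositional using (_⊆_; []; _∷_; _∷ʳ_)
open import Data.List.Relation.Unary.All using (All; all?)
open import Data.List.Relation.Unary.Any using (here)
open import Data.List.Relation.Unary.Linked using (Linked; linked?)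
open import Data.Nat
open import Data.Nat.Properties
open import Data.Product.Base using (_×_; _,_; proj₁; proj₂; ∃-syntax)
open import Data.Sum.Base using (_⊎_; inj₁; inj₂)
open import Data.Vec.Base using (Vec; lookup; toList)
open import Data.Vec.Functional using (Vector)
open import Function.Base using (_∘_)
open import Function.Bundles using (_⇔_; mk⇔; Equivalence)
open import Function.Definitions using (Inverseˡ; Inverseʳ; Inverseᵇ)
open import Relation.Binary.PropositionalEquality
  using (_≡_; refl; sym; trans; cong; cong₂; subst; module ≡-Reasoning)
open import Relation.Nullary using (¬_; yes; no; does; contradiction; _×-dec_)
open import Relation.Unary using (Decidable)

open Equivalence using (to; from)

-- Number of j < N satisfying P.
card : {P : ℕ → Set} → Decidable P → ℕ → ℕ
card P? N = length (filter P? (upTo N))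

------------------------------------------------------------------------
-- Plane partitions

-- Rows and columns are numbered from 0.  Having finitely many nonzero
-- entries means that they all lie in some support × support box.
record PlanePartition : Set where
  field
    entry        : ℕ → ℕ → ℕ
    decreasing-↓ : ∀ i j → entry (suc i) j ≤ entry i j
    decreasing-→ : ∀ i j → entry i (suc j) ≤ entry i j
    support      : ℕ
    vanishing    : ∀ i j → support ≤ i ⊎ support ≤ j → entry i j ≡ 0

-- A partition is given as an infinite sequence, hence up to trailing zeros.
shape : PlanePartition → ℕ → ℕ
shape π i = card (λ j → 0 <? entry i j) support
  where open PlanePartition π

-- The nonzero rows form an initial segment, so there are at most m of
-- them iff all rows with (0-based) index ≥ m vanish.
record BoundedPlanePartition (m n : ℕ) : Set where
  field
    partition : PlanePartition
  open PlanePartition partition public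
  field
    rows≤m    : ∀ i j → m ≤ i → entry i j ≡ 0
    entries≤n : ∀ i j → entry i j ≤ n

open BoundedPlanePartition

infix 4 _≈_ _≋_

_≈_ : ∀ {m n} → BoundedPlanePartition m n → BoundedPlanePartition m n → Set
π ≈ ρ = ∀ i j → entry π i j ≡ entry ρ i j

Matrix : ℕ → ℕ → Set
Matrix m n = Vector (Vector ℕ n) m

_≋_ : ∀ {m n} → Matrix m n → Matrix m n → Set
d ≋ e = ∀ i ℓ → d i ℓ ≡ e i ℓ

-- The column index ℓ : Fin n stands for the entry value suc (toℕ ℓ).
Φ : ∀ {m n} → BoundedPlanePartition m n → Matrix m n
Φ π i ℓ = card (λ j → entry π (toℕ i) j ≟ suc (toℕ ℓ)
                      ×-dec suc (toℕ ℓ) >? entry π (suc (toℕ i)) j)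
               (support π)

------------------------------------------------------------------------
-- Counting lemmas

module _ {P : ℕ → Set} (P? : Decidable P) where

  card-suc : ∀ N → card P? (suc N) ≡ card P? N + (if does (P? N) then 1 else 0)
  card-suc N = begin
    length (filter P? (upTo (suc N)))
      ≡⟨ cong (length ∘ filter P?) (sym (upTo-∷ʳ N)) ⟩
    length (filter P? (upTo N ++ N ∷ []))
      ≡⟨ cong length (filter-++ P? (upTo N) (N ∷ [])) ⟩
    length (filter P? (upTo N) ++ filter P? (N ∷ []))
      ≡⟨ length-++ (filter P? (upTo N)) ⟩
    card P? N + length (filter P? (N ∷ []))
      ≡⟨ cong (card P? N +_) last ⟩
    card P? N + (if does (P? N) then 1 else 0) ∎
    where
    open ≡-Reasoning
    last : length (filter P? (N ∷ [])) ≡ (if does (P? N) then 1 else 0)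
    last with does (P? N)
    ... | true  = refl
    ... | false = refl

  card-interval : ∀ {lo hi} → (∀ j → P j ⇔ (lo ≤ j × j < hi)) →
                  ∀ N → card P? N ≡ (hi ⊓ N) ∸ lo
  card-interval {lo} {hi} char zero =
    sym (trans (cong (_∸ lo) (⊓-zeroʳ hi)) (0∸n≡0 lo))
  card-interval {lo} {hi} char (suc N)
    rewrite card-suc N | card-interval char N with P? N
  ... | yes p = begin
    ((hi ⊓ N) ∸ lo) + 1  ≡⟨ +-comm _ 1 ⟩
    suc ((hi ⊓ N) ∸ lo)  ≡⟨ cong (λ x → suc (x ∸ lo)) (m≥n⇒m⊓n≡n (<⇒≤ N<hi)) ⟩
    suc (N ∸ lo)         ≡⟨ sym (+-∸-assoc 1 lo≤N) ⟩
    suc N ∸ lo           ≡⟨ cong (_∸ lo) (sym (m≥n⇒m⊓n≡n N<hi)) ⟩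
    (hi ⊓ suc N) ∸ lo    ∎
    where
    open ≡-Reasoning
    lo≤N = proj₁ (to (char N) p)
    N<hi = proj₂ (to (char N) p)
  ... | no ¬p with hi ≤? N
  ...   | yes hi≤N = trans (+-identityʳ _) (cong (_∸ lo)
          (trans (m≤n⇒m⊓n≡m hi≤N) (sym (m≤n⇒m⊓n≡m (m≤n⇒m≤1+n hi≤N)))))
  ...   | no hi≰N with lo ≤? N
  ...     | yes lo≤N = contradiction (from (char N) (lo≤N , ≰⇒> hi≰N)) ¬p
  ...     | no lo≰N = trans (+-identityʳ _) (trans
            (m≤n⇒m∸n≡0 (≤-trans (m⊓n≤n hi N) (<⇒≤ (≰⇒> lo≰N))))
            (sym (m≤n⇒m∸n≡0 (≤-trans (m⊓n≤n hi (suc N)) (≰⇒> lo≰N)))))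

  module _ (down : ∀ {j k} → j ≤ k → P k → P j) where

    threshold : ∀ N → (∀ {j} → P j → j < N) →
                ∃[ k ] k ≤ N × (∀ j → P j ⇔ j < k)
    threshold zero bound =
      0 , z≤n , λ j → mk⇔ bound (λ ())
    threshold (suc N) bound with P? N
    ... | yes p = suc N , ≤-refl , λ j → mk⇔ bound (λ j<1+N → down (≤-pred j<1+N) p)
    ... | no ¬p with threshold N
                     (λ q → ≤∧≢⇒< (≤-pred (bound q)) (λ { refl → ¬p q }))
    ...   | k , k≤N , char = k , m≤n⇒m≤1+n k≤N , char

    card-down : ∀ N → (∀ {j} → P j → j < N) → ∀ j → P j ⇔ j < card P? N
    card-down N bound j with threshold N bound
    ... | k , k≤N , char = subst (λ c → P j ⇔ j < c) (sym card≡k) (char j)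
      where
      card≡k : card P? N ≡ k
      card≡k = trans
        (card-interval (λ j → mk⇔ (λ p → z≤n , to (char j) p)
                                  (λ q → from (char j) (proj₂ q))) N)
        (m≤n⇒m⊓n≡m k≤N)

≤-from-< : ∀ {a b} → (∀ k → k < a → k < b) → a ≤ b
≤-from-< {zero}  f = z≤n
≤-from-< {suc a} f = f a ≤-refl

≡-from-< : ∀ {a b} → (∀ k → k < a ⇔ k < b) → a ≡ b
≡-from-< f = ≤-antisym (≤-from-< (to ∘ f)) (≤-from-< (from ∘ f))

antitone : (f : ℕ → ℕ) → (∀ i → f (suc i) ≤ f i) → ∀ {i j} → i ≤ j → f j ≤ f i
antitone f step = go ∘ ≤⇒≤′
  where
  go : ∀ {i j} → i ≤′ j → f j ≤ f i
  go ≤′-refl       = ≤-refl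
  go (≤′-step i≤j) = ≤-trans (step _) (go i≤j)

------------------------------------------------------------------------
-- Φ is a bijection, with inverse Φ⁻¹ (see Φ-inverse)

-- f i ℓ plays the role of the number of entries exceeding ℓ in row i of
-- the plane partition corresponding to d.
record Solves {m n} (d : Matrix m n) (f : ℕ → ℕ → ℕ) : Set where
  field
    rec     : ∀ i ℓ → f (toℕ i) (toℕ ℓ)
                      ≡ d i ℓ + (f (suc (toℕ i)) (toℕ ℓ) ⊔ f (toℕ i) (suc (toℕ ℓ)))
    outside : ∀ i ℓ → m ≤ i ⊎ n ≤ ℓ → f i ℓ ≡ 0

open Solves

solution : ∀ {m n} → Matrix m n → ℕ → ℕ → ℕ
solution {zero}          d i       ℓ       = 0
solution {suc m} {zero}  d i       ℓ       = 0
solution {suc m} {suc n} d (suc i) ℓ       = solution (d ∘ Fin.suc) i ℓ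
solution {suc m} {suc n} d zero    (suc ℓ) = solution (λ i → d i ∘ Fin.suc) zero ℓ
solution {suc m} {suc n} d zero    zero    =
  d Fin.zero Fin.zero + (solution (d ∘ Fin.suc) zero zero
                         ⊔ solution (λ i → d i ∘ Fin.suc) zero zero)

-- Discarding the first column commutes with taking the solution.
solution-column : ∀ {m n} (d : Matrix m (suc n)) i ℓ →
                  solution (λ i → d i ∘ Fin.suc) i ℓ ≡ solution d i (suc ℓ)
solution-column {zero}          d i       ℓ = refl
solution-column {suc m} {zero}  d zero    ℓ = refl
solution-column {suc m} {zero}  d (suc i) ℓ =
  trans (sym (empty (λ i → d (Fin.suc i) ∘ Fin.suc) i ℓ)) (solution-column (d ∘ Fin.suc) i ℓ)
  where
  empty : ∀ {m} (e : Matrix m 0) i ℓ → solution e i ℓ ≡ 0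
  empty {zero}  e i ℓ = refl
  empty {suc m} e i ℓ = refl
solution-column {suc m} {suc n} d zero    ℓ = refl
solution-column {suc m} {suc n} d (suc i) ℓ = solution-column (d ∘ Fin.suc) i ℓ

solution-solves : ∀ {m n} (d : Matrix m n) → Solves d (solution d)
solution-solves d = record { rec = rc d ; outside = out d }
  where
  rc : ∀ {m n} (d : Matrix m n) i ℓ → solution d (toℕ i) (toℕ ℓ)
       ≡ d i ℓ + (solution d (suc (toℕ i)) (toℕ ℓ) ⊔ solution d (toℕ i) (suc (toℕ ℓ)))
  rc {suc m} {suc n} d Fin.zero    Fin.zero    = refl
  rc {suc m} {suc n} d Fin.zero    (Fin.suc ℓ) =
    trans (rc (λ i → d i ∘ Fin.suc) Fin.zero ℓ)
          (cong (λ x → d Fin.zero (Fin.suc ℓ)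
                       + (x ⊔ solution (λ i → d i ∘ Fin.suc) zero (suc (toℕ ℓ))))
                (solution-column d 1 (toℕ ℓ)))
  rc {suc m} {suc n} d (Fin.suc i) ℓ           = rc (d ∘ Fin.suc) i ℓ

  out : ∀ {m n} (d : Matrix m n) i ℓ → m ≤ i ⊎ n ≤ ℓ → solution d i ℓ ≡ 0
  out {zero}          d i       ℓ       h = refl
  out {suc m} {zero}  d i       ℓ       h = refl
  out {suc m} {suc n} d zero    zero    (inj₁ ())
  out {suc m} {suc n} d zero    zero    (inj₂ ())
  out {suc m} {suc n} d zero    (suc ℓ) (inj₂ h) = out (λ i → d i ∘ Fin.suc) zero ℓ (inj₂ (≤-pred h))
  out {suc m} {suc n} d (suc i) ℓ       (inj₁ h) = out (d ∘ Fin.suc) i ℓ (inj₁ (≤-pred h))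
  out {suc m} {suc n} d (suc i) ℓ       (inj₂ h) = out (d ∘ Fin.suc) i ℓ (inj₂ h)

solution-unique : ∀ {m n} (d : Matrix m n) {f} → Solves d f → ∀ i ℓ → f i ℓ ≡ solution d i ℓ
solution-unique {zero}          d S i ℓ = outside S i ℓ (inj₁ z≤n)
solution-unique {suc m} {zero}  d S i ℓ = outside S i ℓ (inj₂ z≤n)
solution-unique {suc m} {suc n} d {f} S = go
  where
  below : ∀ i ℓ → f (suc i) ℓ ≡ solution (d ∘ Fin.suc) i ℓ
  below = solution-unique (d ∘ Fin.suc) record
    { rec     = λ i ℓ → rec S (Fin.suc i) ℓ
    ; outside = λ { i ℓ (inj₁ h) → outside S (suc i) ℓ (inj₁ (s≤s h))
                  ; i ℓ (inj₂ h) → outside S (suc i) ℓ (inj₂ h) } }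

  right : ∀ i ℓ → f i (suc ℓ) ≡ solution (λ i → d i ∘ Fin.suc) i ℓ
  right = solution-unique (λ i → d i ∘ Fin.suc) record
    { rec     = λ i ℓ → rec S i (Fin.suc ℓ)
    ; outside = λ { i ℓ (inj₁ h) → outside S i (suc ℓ) (inj₁ h)
                  ; i ℓ (inj₂ h) → outside S i (suc ℓ) (inj₂ (s≤s h)) } }

  go : ∀ i ℓ → f i ℓ ≡ solution d i ℓ
  go (suc i) ℓ       = below i ℓ
  go zero    (suc ℓ) = right zero ℓ
  go zero    zero    = trans (rec S Fin.zero Fin.zero)
    (cong (d Fin.zero Fin.zero +_) (cong₂ _⊔_ (below 0 0) (right 0 0)))

module _ {m n} {d : Matrix m n} {f : ℕ → ℕ → ℕ} (S : Solves d f) where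

  private
    inside : ∀ {i ℓ} → i < m → ℓ < n → f (suc i) ℓ ≤ f i ℓ × f i (suc ℓ) ≤ f i ℓ
    inside {i} {ℓ} i<m ℓ<n with rec S (fromℕ< i<m) (fromℕ< ℓ<n)
    ... | eq rewrite Finₚ.toℕ-fromℕ< i<m | Finₚ.toℕ-fromℕ< ℓ<n | eq =
      ≤-trans (m≤m⊔n _ _) (m≤n+m _ (d _ _)) , ≤-trans (m≤n⊔m _ _) (m≤n+m _ (d _ _))

  solves-↓ : ∀ i ℓ → f (suc i) ℓ ≤ f i ℓ
  solves-↓ i ℓ with i <? m | ℓ <? n
  ... | yes i<m | yes ℓ<n = proj₁ (inside i<m ℓ<n)
  ... | no i≮m  | _       = ≤-trans (≤-reflexive (outside S _ _ (inj₁ (m≤n⇒m≤1+n (≮⇒≥ i≮m))))) z≤n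
  ... | yes _   | no ℓ≮n  = ≤-trans (≤-reflexive (outside S _ _ (inj₂ (≮⇒≥ ℓ≮n)))) z≤n

  solves-→ : ∀ i ℓ → f i (suc ℓ) ≤ f i ℓ
  solves-→ i ℓ with i <? m | ℓ <? n
  ... | yes i<m | yes ℓ<n = proj₂ (inside i<m ℓ<n)
  ... | no i≮m  | _       = ≤-trans (≤-reflexive (outside S _ _ (inj₁ (≮⇒≥ i≮m)))) z≤n
  ... | yes _   | no ℓ≮n  = ≤-trans (≤-reflexive (outside S _ _ (inj₂ (m≤n⇒m≤1+n (≮⇒≥ ℓ≮n))))) z≤n

module _ {m n} (π : BoundedPlanePartition m n) where

  exceeding : ℕ → ℕ → ℕ
  exceeding i ℓ = card (λ j → ℓ <? entry π i j) (support π)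

  private
    bounded : ∀ {i ℓ j} → ℓ < entry π i j → j < support π
    bounded {i} {ℓ} {j} ℓ<a with j <? support π
    ... | yes j<N = j<N
    ... | no j≮N  = contradiction (subst (ℓ <_) (vanishing π i j (inj₂ (≮⇒≥ j≮N))) ℓ<a) (λ ())

  exceeding-char : ∀ i ℓ j → ℓ < entry π i j ⇔ j < exceeding i ℓ
  exceeding-char i ℓ = card-down (λ j → ℓ <? entry π i j)
    (λ j≤k ℓ<a → <-≤-trans ℓ<a (antitone (entry π i) (decreasing-→ π i) j≤k))
    (support π) bounded

  exceeding≤support : ∀ i ℓ → exceeding i ℓ ≤ support π
  exceeding≤support i ℓ = ≤-from-< (λ j j<e → bounded (from (exceeding-char i ℓ j) j<e))

  exceeding-solves : Solves (Φ π) exceeding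
  exceeding-solves = record { rec = rc ; outside = out }
    where
    rc : ∀ i ℓ → exceeding (toℕ i) (toℕ ℓ)
         ≡ Φ π i ℓ + (exceeding (suc (toℕ i)) (toℕ ℓ) ⊔ exceeding (toℕ i) (suc (toℕ ℓ)))
    rc i′ ℓ′ = sym (trans (cong (_+ lo) Φ≡) (m∸n+n≡m lo≤hi))
      where
      i  = toℕ i′
      ℓ  = toℕ ℓ′
      hi = exceeding i ℓ
      lo = exceeding (suc i) ℓ ⊔ exceeding i (suc ℓ)

      lo≤hi : lo ≤ hi
      lo≤hi = ⊔-lub
        (≤-from-< λ j h → to (exceeding-char i ℓ j)
          (<-≤-trans (from (exceeding-char (suc i) ℓ j) h) (decreasing-↓ π i j)))
        (≤-from-< λ j h → to (exceeding-char i ℓ j)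
          (<⇒≤ (from (exceeding-char i (suc ℓ) j) h)))

      char : ∀ j → (entry π i j ≡ suc ℓ × suc ℓ > entry π (suc i) j) ⇔ (lo ≤ j × j < hi)
      char j = mk⇔
        (λ { (a≡ , b<) →
             ⊔-lub (≮⇒≥ λ h → <⇒≱ (from (exceeding-char (suc i) ℓ j) h) (≤-pred b<))
                   (≮⇒≥ λ h → <⇒≱ (from (exceeding-char i (suc ℓ) j) h) (≤-reflexive a≡))
             , to (exceeding-char i ℓ j) (≤-reflexive (sym a≡)) })
        (λ { (lo≤j , j<hi) →
             ≤-antisym
               (≮⇒≥ λ h → <⇒≱ (to (exceeding-char i (suc ℓ) j) h)
                              (≤-trans (m≤n⊔m (exceeding (suc i) ℓ) _) lo≤j))
               (from (exceeding-char i ℓ j) j<hi)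
             , s≤s (≮⇒≥ λ h → <⇒≱ (to (exceeding-char (suc i) ℓ j) h)
                                  (≤-trans (m≤m⊔n _ _) lo≤j)) })

      Φ≡ : Φ π i′ ℓ′ ≡ hi ∸ lo
      Φ≡ = trans (card-interval _ char (support π))
                 (cong (_∸ lo) (m≤n⇒m⊓n≡m (exceeding≤support i ℓ)))

    out : ∀ i ℓ → m ≤ i ⊎ n ≤ ℓ → exceeding i ℓ ≡ 0
    out i ℓ h = n≤0⇒n≡0 (≤-from-< λ j j<e → absurd h (from (exceeding-char i ℓ j) j<e))
      where
      absurd : ∀ {j k} → m ≤ i ⊎ n ≤ ℓ → ℓ < entry π i j → k < 0
      absurd {j} (inj₁ m≤i) ℓ<a = contradiction (subst (ℓ <_) (rows≤m π i j m≤i) ℓ<a) (λ ())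
      absurd {j} (inj₂ n≤ℓ) ℓ<a = contradiction (≤-trans (entries≤n π i j) n≤ℓ) (<⇒≱ ℓ<a)

module _ {m n} (d : Matrix m n) where

  private
    S = solution-solves d

    e : ℕ → ℕ → ℕ
    e i j = card (λ ℓ → j <? solution d i ℓ) n

    bounded : ∀ {i j ℓ} → j < solution d i ℓ → ℓ < n
    bounded {i} {j} {ℓ} j<s with ℓ <? n
    ... | yes ℓ<n = ℓ<n
    ... | no ℓ≮n  = contradiction (subst (j <_) (outside S i ℓ (inj₂ (≮⇒≥ ℓ≮n))) j<s) (λ ())

    e-char : ∀ i j ℓ → j < solution d i ℓ ⇔ ℓ < e i j
    e-char i j = card-down (λ ℓ → j <? solution d i ℓ)
      (λ k≤ℓ j<s → <-≤-trans j<s (antitone (solution d i) (solves-→ S i) k≤ℓ)) n bounded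

    N : ℕ
    N = m ⊔ solution d 0 0

    vanish : ∀ i j → N ≤ i ⊎ N ≤ j → e i j ≡ 0
    vanish i j h = n≤0⇒n≡0 (≤-from-< λ ℓ ℓ<e → absurd h (from (e-char i j ℓ) ℓ<e))
      where
      absurd : ∀ {ℓ k} → N ≤ i ⊎ N ≤ j → j < solution d i ℓ → k < 0
      absurd {ℓ} (inj₁ N≤i) j<s =
        contradiction (subst (j <_) (outside S i ℓ (inj₁ (≤-trans (m≤m⊔n m _) N≤i))) j<s) (λ ())
      absurd {ℓ} (inj₂ N≤j) j<s = contradiction (begin
        solution d i ℓ  ≤⟨ antitone (solution d i) (solves-→ S i) z≤n ⟩
        solution d i 0  ≤⟨ antitone (λ i → solution d i 0) (λ i → solves-↓ S i 0) z≤n ⟩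
        solution d 0 0  ≤⟨ m≤n⊔m m _ ⟩
        N               ≤⟨ N≤j ⟩
        j               ∎) (<⇒≱ j<s)
        where open ≤-Reasoning

  Φ⁻¹ : BoundedPlanePartition m n
  Φ⁻¹ = record
    { partition = record
      { entry        = e
      ; decreasing-↓ = λ i j → ≤-from-< λ ℓ ℓ<e →
          to (e-char i j ℓ) (<-≤-trans (from (e-char (suc i) j ℓ) ℓ<e) (solves-↓ S i ℓ))
      ; decreasing-→ = λ i j → ≤-from-< λ ℓ ℓ<e →
          to (e-char i j ℓ) (<⇒≤ (from (e-char i (suc j) ℓ) ℓ<e))
      ; support      = N
      ; vanishing    = vanish
      }
    ; rows≤m    = λ i j m≤i → n≤0⇒n≡0 (≤-from-< λ ℓ ℓ<e → contradiction
        (subst (j <_) (outside S i ℓ (inj₁ m≤i)) (from (e-char i j ℓ) ℓ<e)) (λ ()))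
    ; entries≤n = λ i j → ≤-from-< λ ℓ ℓ<e → bounded (from (e-char i j ℓ) ℓ<e)
    }

  Φ⁻¹-char : ∀ i j ℓ → j < solution d i ℓ ⇔ ℓ < entry Φ⁻¹ i j
  Φ⁻¹-char = e-char

Φ-inverse : ∀ {m n} → Inverseᵇ (_≈_ {m} {n}) _≋_ Φ Φ⁻¹
Φ-inverse {m} {n} =
  (λ {d} {π} → left {d} {π}) , (λ {π} {d} → right {π} {d})
  where
  left : Inverseˡ (_≈_ {m} {n}) _≋_ Φ Φ⁻¹
  left {d} {π} π≈ i′ ℓ′ = +-cancelʳ-≡ (s (suc i) ℓ ⊔ s i (suc ℓ)) _ _ (begin
    Φ π i′ ℓ′ + (s (suc i) ℓ ⊔ s i (suc ℓ))
      ≡⟨ cong (Φ π i′ ℓ′ +_) (sym (cong₂ _⊔_ (x≡s (suc i) ℓ) (x≡s i (suc ℓ)))) ⟩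
    Φ π i′ ℓ′ + (exceeding π (suc i) ℓ ⊔ exceeding π i (suc ℓ))
      ≡⟨ sym (rec (exceeding-solves π) i′ ℓ′) ⟩
    exceeding π i ℓ
      ≡⟨ x≡s i ℓ ⟩
    s i ℓ
      ≡⟨ rec (solution-solves d) i′ ℓ′ ⟩
    d i′ ℓ′ + (s (suc i) ℓ ⊔ s i (suc ℓ)) ∎)
    where
    open ≡-Reasoning
    i = toℕ i′
    ℓ = toℕ ℓ′
    s = solution d
    x≡s : ∀ i ℓ → exceeding π i ℓ ≡ s i ℓ
    x≡s i ℓ = ≡-from-< λ j → mk⇔
      (λ h → from (Φ⁻¹-char d i j ℓ) (subst (ℓ <_) (π≈ i j) (from (exceeding-char π i ℓ j) h)))
      (λ h → to (exceeding-char π i ℓ j) (subst (ℓ <_) (sym (π≈ i j)) (to (Φ⁻¹-char d i j ℓ) h)))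

  right : Inverseʳ (_≈_ {m} {n}) _≋_ Φ Φ⁻¹
  right {π} {d} d≋ i j = ≡-from-< λ ℓ → mk⇔
    (λ h → from (exceeding-char π i ℓ j) (subst (j <_) (sym (x≡s i ℓ)) (from (Φ⁻¹-char d i j ℓ) h)))
    (λ h → to (Φ⁻¹-char d i j ℓ) (subst (j <_) (x≡s i ℓ) (to (exceeding-char π i ℓ j) h)))
    where
    x≡s : ∀ i ℓ → exceeding π i ℓ ≡ solution d i ℓ
    x≡s = solution-unique d record
      { rec     = λ i ℓ → trans (rec (exceeding-solves π) i ℓ) (cong (_+ _) (sym (d≋ i ℓ)))
      ; outside = outside (exceeding-solves π) }

------------------------------------------------------------------------
-- Words

-- The element x : Fin m stands for the letter suc (toℕ x) of [m].
Word : ℕ → ℕ → Set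
Word n m = Vec (Fin m) n

D : ∀ {n m} → Word n m → Matrix m n
D w i j = if does (lookup w j Fin.≟ i) then 1 else 0

subsequences : {A : Set} → List A → List (List A)
subsequences []       = [] ∷ []
subsequences (x ∷ xs) = subsequences xs ++ map (x ∷_) (subsequences xs)

∈-subsequences : {A : Set} {u : List A} (xs : List A) → u ∈ subsequences xs ⇔ u ⊆ xs
∈-subsequences xs = mk⇔ (sound xs) complete
  where
  sound : {A : Set} {u : List A} (xs : List A) → u ∈ subsequences xs → u ⊆ xs
  sound []       (here refl) = []
  sound (x ∷ xs) u∈ with ∈-++⁻ (subsequences xs) u∈
  ... | inj₁ u∈′ = x ∷ʳ sound xs u∈′
  ... | inj₂ u∈′ with ∈-map⁻ (x ∷_) u∈′
  ...   | v , v∈ , refl = refl ∷ sound xs v∈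

  complete : {A : Set} {u xs : List A} → u ⊆ xs → u ∈ subsequences xs
  complete []         = here refl
  complete (x ∷ʳ u⊆)  = ∈-++⁺ˡ (complete u⊆)
  complete (_∷_ {ys = ys} refl u⊆) =
    ∈-++⁺ʳ (subsequences ys) (∈-map⁺ _ (complete u⊆))

-- Weakly increasing with all letters in {m - i + 1, …, m}.
Admissible : ∀ {m} → ℕ → List (Fin m) → Set
Admissible {m} i u = Linked Fin._≤_ u × All (λ x → m ∸ i + 1 ≤ suc (toℕ x)) u

admissible? : ∀ {m} i → Decidable (Admissible {m} i)
admissible? {m} i u = linked? Fin._≤?_ u ×-dec all? (λ x → m ∸ i + 1 ≤? suc (toℕ x)) u

L : ∀ {n m} → ℕ → Word n m → ℕ
L i w = max 0 (map length (filter (admissible? i) (subsequences (toList w))))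

-- A finite sequence continued by zeros, for comparison with a shape.
zeroPadded : List ℕ → ℕ → ℕ
zeroPadded []       k       = 0
zeroPadded (x ∷ xs) zero    = x
zeroPadded (x ∷ xs) (suc k) = zeroPadded xs k

{-# OPTIONS --safe #-}

-- Let s k be the length of row k of π, i.e. the value of solution (D w) at
-- (k , 0).  For a word x ∷ w, the recursion for solution bounds s (x ∷ w) k below
-- by s w k and, if k ≤ x, by 1 + s w x; conversely one of these two values is
-- attained.  This is the recursion for the longest weakly increasing
-- subsequence with letters ≥ k, split according to whether x is used.
module Submission where

open import Defs
open import Data.Bool.Base using (if_then_else_)
open import Data.Fin as Fin using (Fin; toℕ; fromℕ<)
import Data.Fin.Properties as Finₚ
open import Data.List.Base using ([]; _∷_; applyDownFrom; filter; length; map)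
open import Data.List.Extrema.Nat using (max≤v⁺; xs≤max)
open import Data.List.Membership.Propositional using (_∈_)
open import Data.List.Membership.Propositional.Properties
  using (∈-map⁺; ∈-map⁻; ∈-filter⁺; ∈-filter⁻)
open import Data.List.Relation.Binary.Sublist.Propositional using (_⊆_; []; _∷_; _∷ʳ_)
open import Data.List.Relation.Unary.All as All using (All; []; _∷_)
open import Data.List.Relation.Unary.AllPairs using (_∷_)
open import Data.List.Relation.Unary.Linked using (Linked; [])
open import Data.List.Relation.Unary.Linked.Properties using (Linked⇒AllPairs; AllPairs⇒Linked)
open import Data.Nat.Base using (ℕ; zero; suc; _+_; _∸_; _⊔_; _≤_; _<_; z≤n; s≤s)
open import Data.Nat.Properties
open import Data.Product.Base using (_×_; _,_; ∃-syntax)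
open import Data.Sum.Base using (_⊎_; inj₁; inj₂)
open import Data.Vec.Base using ([]; _∷_; toList)
open import Function.Bundles using (mk⇔; Equivalence)
open import Relation.Binary.PropositionalEquality
  using (_≡_; _≗_; refl; sym; trans; cong; subst; module ≡-Reasoning)
open import Relation.Nullary using (yes; no; does; contradiction)
open import Relation.Nullary.Decidable using (dec-true)

open Equivalence using (to; from)

rowLength : ∀ {n m} → Word n m → ℕ → ℕ
rowLength w k = solution (D w) k 0

-- At `ℓ = 0` the count `exceeding` is the shape, so `exceeding-char` and `Φ⁻¹-char` show that the
-- same `j` lie below both numbers.
shape-Φ⁻¹ : ∀ {m n} (d : Matrix m n) k →
            shape (BoundedPlanePartition.partition (Φ⁻¹ d)) k ≡ solution d k 0
shape-Φ⁻¹ d k = ≡-from-< λ j → mk⇔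
  (λ h → from (Φ⁻¹-char d k j 0) (from (exceeding-char (Φ⁻¹ d) k 0 j) h))
  (λ h → to (exceeding-char (Φ⁻¹ d) k 0 j) (to (Φ⁻¹-char d k j 0) h))

rowLength-outside : ∀ {n m} (w : Word n m) {k} → m ≤ k → rowLength w k ≡ 0
rowLength-outside w m≤k = Solves.outside (solution-solves (D w)) _ 0 (inj₁ m≤k)

rowLength-antitone : ∀ {n m} (w : Word n m) {k l} → k ≤ l → rowLength w l ≤ rowLength w k
rowLength-antitone w = antitone (rowLength w) (λ k → solves-↓ (solution-solves (D w)) k 0)

-- Removing the first column of `D (x ∷ w)` leaves `D w`, so `solution-column` turns the column-1
-- term of the recursion into `rowLength w`.
rowLength-rec : ∀ {n m} (x : Fin m) (w : Word n m) i →
  rowLength (x ∷ w) (toℕ i) ≡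
  (if does (x Fin.≟ i) then 1 else 0) + (rowLength (x ∷ w) (suc (toℕ i)) ⊔ rowLength w (toℕ i))
rowLength-rec x w i = trans
  (Solves.rec (solution-solves (D (x ∷ w))) i Fin.zero)
  (cong (λ y → D (x ∷ w) i Fin.zero + (rowLength (x ∷ w) (suc (toℕ i)) ⊔ y))
        (sym (solution-column (D (x ∷ w)) (toℕ i) 0)))

rowLength-skip : ∀ {n m} (x : Fin m) (w : Word n m) k → rowLength w k ≤ rowLength (x ∷ w) k
rowLength-skip x w k = subst (_≤ rowLength (x ∷ w) k)
  (sym (solution-column (D (x ∷ w)) k 0)) (solves-→ (solution-solves (D (x ∷ w))) k 0)

-- The 1 that `x` puts in row `toℕ x` of the first column adds one there; antitonicity in the row
-- index carries the bound to smaller `k`.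
rowLength-take : ∀ {n m} (x : Fin m) (w : Word n m) {k} → k ≤ toℕ x →
                 suc (rowLength w (toℕ x)) ≤ rowLength (x ∷ w) k
rowLength-take x w {k} k≤x = begin
  suc (rowLength w (toℕ x))
    ≤⟨ s≤s (m≤n⊔m (rowLength (x ∷ w) (suc (toℕ x))) _) ⟩
  1 + (rowLength (x ∷ w) (suc (toℕ x)) ⊔ rowLength w (toℕ x))
    ≡⟨ cong (λ b → (if b then 1 else 0) + (rowLength (x ∷ w) (suc (toℕ x)) ⊔ rowLength w (toℕ x)))
            (dec-true (x Fin.≟ x) refl) ⟨
  (if does (x Fin.≟ x) then 1 else 0) + (rowLength (x ∷ w) (suc (toℕ x)) ⊔ rowLength w (toℕ x))
    ≡⟨ rowLength-rec x w x ⟨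
  rowLength (x ∷ w) (toℕ x)
    ≤⟨ rowLength-antitone (x ∷ w) k≤x ⟩
  rowLength (x ∷ w) k ∎
  where open ≤-Reasoning

-- Descending induction on `k`: the counter `c` keeps `m ≤ c + k`, so it reaches zero only at rows
-- beyond the matrix, where the value is 0.
rowLength-∷ : ∀ {n m} (x : Fin m) (w : Word n m) k →
  rowLength (x ∷ w) k ≤ rowLength w k ⊎
  k ≤ toℕ x × rowLength (x ∷ w) k ≤ suc (rowLength w (toℕ x))
rowLength-∷ {m = m} x w k = go m k (m≤m+n m k)
  where
  go : ∀ c k → m ≤ c + k →
       rowLength (x ∷ w) k ≤ rowLength w k ⊎
       k ≤ toℕ x × rowLength (x ∷ w) k ≤ suc (rowLength w (toℕ x))
  -- The row is taken in `Fin m` so that `rowLength-rec` applies and `x` can be compared with it.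
  step : ∀ c i → m ≤ suc c + toℕ i →
       rowLength (x ∷ w) (toℕ i) ≤ rowLength w (toℕ i) ⊎
       toℕ i ≤ toℕ x × rowLength (x ∷ w) (toℕ i) ≤ suc (rowLength w (toℕ x))
  go zero    k m≤k = inj₁ (≤-trans (≤-reflexive (rowLength-outside (x ∷ w) m≤k)) z≤n)
  go (suc c) k m≤  with k <? m
  ... | no k≮m  = inj₁ (≤-trans (≤-reflexive (rowLength-outside (x ∷ w) (≮⇒≥ k≮m))) z≤n)
  ... | yes k<m with step c (fromℕ< k<m)
  ...   | h rewrite Finₚ.toℕ-fromℕ< k<m = h m≤
  step c i m≤
    with x Fin.≟ i | rowLength-rec x w i
       | go c (suc (toℕ i)) (subst (m ≤_) (sym (+-suc c (toℕ i))) m≤)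
  -- At row `x`, the second alternative for the next row would say `suc (toℕ x) ≤ toℕ x`.
  ... | yes refl | eq | inj₂ (x<x , _) = contradiction x<x (<-irrefl refl)
  ... | yes refl | eq | inj₁ h = inj₂ (≤-refl , ≤-trans (≤-reflexive eq)
    (s≤s (⊔-lub (≤-trans h (rowLength-antitone w (n≤1+n (toℕ i)))) ≤-refl)))
  ... | no _ | eq | inj₁ h = inj₁ (≤-trans (≤-reflexive eq)
    (⊔-lub (≤-trans h (rowLength-antitone w (n≤1+n (toℕ i)))) ≤-refl))
  -- With no 1 in this row, the maximum is either the value for `w` or the value of the next row,
  -- whose bound `h` carries over.
  ... | no _ | eq | inj₂ (i<x , h) with ≤-total (rowLength (x ∷ w) (suc (toℕ i))) (rowLength w (toℕ i))
  ...   | inj₁ le = inj₁ (≤-reflexive (trans eq (m≤n⇒m⊔n≡n le)))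
  ...   | inj₂ ge = inj₂ (<⇒≤ i<x , ≤-trans (≤-reflexive (trans eq (m≥n⇒m⊔n≡m ge))) h)

-- Once `x` is used, all later letters are at least `x`, so the induction hypothesis applies to them
-- with `toℕ x` in place of `k`.
length≤rowLength : ∀ {n m} (w : Word n m) {k u} → u ⊆ toList w →
  Linked Fin._≤_ u → All (λ x → k ≤ toℕ x) u → length u ≤ rowLength w k
length≤rowLength []      []          _ _          = z≤n
length≤rowLength (x ∷ w) (.x ∷ʳ u⊆w) l a          =
  ≤-trans (length≤rowLength w u⊆w l a) (rowLength-skip x w _)
length≤rowLength (x ∷ w) (refl ∷ u⊆w) l (k≤x ∷ _) with Linked⇒AllPairs Finₚ.≤-trans l
... | x≤u ∷ p = ≤-trans (s≤s (length≤rowLength w u⊆w (AllPairs⇒Linked p) x≤u))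
                        (rowLength-take x w k≤x)

-- The alternatives of `rowLength-∷` decide whether `x` is skipped or taken; taking it calls the
-- induction hypothesis at `toℕ x`, so that `x` can be prepended.
rowLength-attained : ∀ {n m} (w : Word n m) k →
  ∃[ u ] u ⊆ toList w × Linked Fin._≤_ u × All (λ x → k ≤ toℕ x) u × rowLength w k ≤ length u
rowLength-attained {m = m} [] k =
  [] , [] , [] , [] , ≤-reflexive (Solves.outside (solution-solves (D {m = m} [])) k 0 (inj₂ z≤n))
rowLength-attained (x ∷ w) k with rowLength-∷ x w k
... | inj₁ h with rowLength-attained w k
...   | u , u⊆w , l , a , le = u , x ∷ʳ u⊆w , l , a , ≤-trans h le
rowLength-attained (x ∷ w) k | inj₂ (k≤x , h) with rowLength-attained w (toℕ x)
...   | u , u⊆w , l , a , le =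
  x ∷ u , refl ∷ u⊆w , AllPairs⇒Linked (a ∷ Linked⇒AllPairs Finₚ.≤-trans l)
  , k≤x ∷ All.map (≤-trans k≤x) a , ≤-trans h (s≤s le)

-- With letters numbered from 0, the bound in `Admissible i` reads `m ∸ i ≤ toℕ x`, which selects
-- row `m ∸ i`.
L≡rowLength : ∀ {n m} (w : Word n m) i → L i w ≡ rowLength w (m ∸ i)
L≡rowLength {m = m} w i = ≤-antisym (max≤v⁺ z≤n (All.tabulate upper)) lower
  where
  xs = subsequences (toList w)
  lengths = map length (filter (admissible? i) xs)

  upper : ∀ {ℓ} → ℓ ∈ lengths → ℓ ≤ rowLength w (m ∸ i)
  upper ℓ∈ with ∈-map⁻ length ℓ∈
  ... | u , u∈ , refl with ∈-filter⁻ (admissible? i) {xs = xs} u∈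
  ...   | u∈′ , l , a = length≤rowLength w (to (∈-subsequences (toList w)) u∈′) l
    (All.map (λ {x} h → ≤-pred (subst (_≤ suc (toℕ x)) (+-comm (m ∸ i) 1) h)) a)

  lower : rowLength w (m ∸ i) ≤ L i w
  lower with rowLength-attained w (m ∸ i)
  ... | u , u⊆w , l , a , le = ≤-trans le (All.lookup (xs≤max 0 lengths)
    (∈-map⁺ length (∈-filter⁺ (admissible? i) (from (∈-subsequences (toList w)) u⊆w)
      (l , All.map (λ {x} h → subst (_≤ suc (toℕ x)) (+-comm 1 (m ∸ i)) (s≤s h)) a))))

zeroPadded-applyDownFrom-< : ∀ f {m k} → k < m →
  zeroPadded (applyDownFrom f m) k ≡ f (m ∸ suc k)
zeroPadded-applyDownFrom-< f {suc m} {zero}  _         = refl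
zeroPadded-applyDownFrom-< f {suc m} {suc k} (s≤s k<m) = zeroPadded-applyDownFrom-< f k<m

zeroPadded-applyDownFrom-≥ : ∀ f {m k} → m ≤ k → zeroPadded (applyDownFrom f m) k ≡ 0
zeroPadded-applyDownFrom-≥ f {zero}          _         = refl
zeroPadded-applyDownFrom-≥ f {suc m} {suc k} (s≤s m≤k) = zeroPadded-applyDownFrom-≥ f m≤k

theorem7p6 : ∀ (n m : ℕ) → 1 ≤ n → 1 ≤ m → (w : Word n m) →
    let π = BoundedPlanePartition.partition (Φ⁻¹ (D w)) in
    shape π ≗ zeroPadded (applyDownFrom (λ i → L (suc i) w) m)
theorem7p6 n m _ _ w k with k <? m
... | no k≮m = trans (shape-Φ⁻¹ (D w) k) (trans (rowLength-outside w (≮⇒≥ k≮m))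
  (sym (zeroPadded-applyDownFrom-≥ (λ i → L (suc i) w) (≮⇒≥ k≮m))))
... | yes k<m = begin
  shape (BoundedPlanePartition.partition (Φ⁻¹ (D w))) k   ≡⟨ shape-Φ⁻¹ (D w) k ⟩
  rowLength w k                                           ≡⟨ cong (rowLength w) (m∸[m∸n]≡n (<⇒≤ k<m)) ⟨
  rowLength w (m ∸ (m ∸ k))                               ≡⟨ L≡rowLength w (m ∸ k) ⟨
  -- The list counts down from `m ∸ 1`, so its entry `k` is the function at `m ∸ suc k`; the `suc`
  -- inside the function restores `m ∸ k`.
  L (m ∸ k) w                                             ≡⟨ cong (λ i → L i w) (+-∸-assoc 1 k<m) ⟩
  L (suc (m ∸ suc k)) w                                   ≡⟨ zeroPadded-applyDownFrom-< (λ i → L (suc i) w) k<m ⟨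
  zeroPadded (applyDownFrom (λ i → L (suc i) w) m) k      ∎
  where open ≡-Reasoning
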